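{- Let $n\geq 4$, let $D_n$ be the $n$-dimensional dual cube and let $S=\{x,y,z,w\}$ be a set of four distinct vertices of $D_n$. If the vertices of $S$ lie in exactly three clusters of $D_n$, then there are $n-1$ internally disjoint trees connecting $S$ in $D_n$.
   Context: The $n$-dimensional dual cube $D_n$ has vertex set all binary strings $u_1u_2\cdots u_{2n-1}$ of length $2n-1$; two vertices $u,v$ are adjacent iff they differ in exactly one bit position $i$, and either $1\leq i\leq n-1$ and $u_{2n-1}=v_{2n-1}=0$, or $n\leq i\leq 2n-2$ and $u_{2n-1}=v_{2n-1}=1$, or $i=2n-1$. A cluster of class $0$ is the set of vertices with last bit $0$ and fixed bits in positions $n,\dots,2n-2$; a cluster of class $1$ is the set of vertices with last bit $1$ and fixed bits in positions $1,\dots,n-1$; each induces a copy of $Q_{n-1}$, and the clusters partition $V(D_n)$. Trees $T_1,\dots,T_m$ in a graph $G$ are internally disjoint trees connecting $S$ if each $T_i$ is a tree containing $S$, the trees are pairwise edge-disjoint, and $V(T_i)\cap V(T_j)=S$ for all $i\neq j$. -}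

module Defs where

open import Data.Nat using (ℕ; zero; suc; _+_; _*_; _∸_; _≤_)
open import Data.Bool using (Bool; true; false)
open import Data.Vec using (Vec; toList)
open import Data.List using (List; []; _∷_; _++_; [_]; map; length; upTo; deduplicate)
open import Data.List.Membership.Propositional using (_∈_)
open import Data.List.Relation.Unary.Unique.Propositional using (Unique)
open import Data.Product using (Σ; _×_; _,_; ∃; ∃-syntax)
open import Data.Sum using (_⊎_)
open import Data.Unit using (⊤)
open import Data.Fin using (Fin)
open import Relation.Nullary using (¬_)
open import Relation.Binary.PropositionalEquality using (_≡_; _≢_)
open import Relation.Binary.Definitions using (DecidableEquality)
import Data.Bool.Properties as BoolP
import Data.List.Properties as ListP
import Data.Product.Properties as ProdP

-- A vertex of D_n: a binary string u_1 u_2 ... u_{2n-1} of length 2n-1.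
-- (wrapped in a record so that n can be inferred from a vertex)
record Vertex (n : ℕ) : Set where
  constructor vtx
  field
    bits : Vec Bool (2 * n ∸ 1)
open Vertex public

-- 1-based bit lookup in a list (false outside the range 1..length).
bitL : List Bool → ℕ → Bool
bitL [] _ = false
bitL (b ∷ bs) zero = false
bitL (b ∷ bs) (suc zero) = b
bitL (b ∷ bs) (suc (suc k)) = bitL bs (suc k)

bit : ∀ {n} → Vertex n → ℕ → Bool
bit u i = bitL (toList (bits u)) i

lastBit : ∀ {n} → Vertex n → Bool
lastBit {n} u = bit u (2 * n ∸ 1)

Adjacent : (n : ℕ) → Vertex n → Vertex n → Set
Adjacent n u v =
  Σ ℕ λ i →
    (1 ≤ i) × (i ≤ 2 * n ∸ 1)
    × (bit u i ≢ bit v i)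
    × (∀ j → j ≢ i → bit u j ≡ bit v j)
    × ( ((i ≤ n ∸ 1) × (lastBit u ≡ false) × (lastBit v ≡ false))
      ⊎ ((n ≤ i) × (i ≤ 2 * n ∸ 2) × (lastBit u ≡ true) × (lastBit v ≡ true))
      ⊎ (i ≡ 2 * n ∸ 1) )

-- The cluster containing u is identified by its class (last bit) together
-- with its fixed bits: positions n..2n-2 for class 0, positions 1..n-1
-- for class 1.
Cluster : Set
Cluster = Bool × List Bool

positions : ℕ → ℕ → List ℕ
positions a k = map (λ j → a + j) (upTo k)

clusterOf : (n : ℕ) → Vertex n → Cluster
clusterOf n u with lastBit u
... | false = false , map (bit u) (positions n (n ∸ 1))
... | true  = true  , map (bit u) (positions 1 (n ∸ 1))

_≟C_ : DecidableEquality Cluster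
_≟C_ = ProdP.≡-dec BoolP._≟_ (ListP.≡-dec BoolP._≟_)

numClusters : (n : ℕ) → List (Vertex n) → ℕ
numClusters n vs = length (deduplicate _≟C_ (map (clusterOf n) vs))

record Subgraph (n : ℕ) : Set where
  field
    verts : List (Vertex n)
    edges : List (Vertex n × Vertex n)   -- undirected edges {u,v} given as pairs
open Subgraph public

EdgeIn : ∀ {n} → List (Vertex n × Vertex n) → Vertex n → Vertex n → Set
EdgeIn E u v = ((u , v) ∈ E) ⊎ ((v , u) ∈ E)

data Walk {n : ℕ} (E : List (Vertex n × Vertex n)) : Vertex n → Vertex n → Set where
  stay : ∀ {u} → Walk E u u
  step : ∀ {u w v} → EdgeIn E u w → Walk E w v → Walk E u v

Chain : ∀ {n} → List (Vertex n × Vertex n) → List (Vertex n) → Set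
Chain E [] = ⊤
Chain E (a ∷ []) = ⊤
Chain E (a ∷ b ∷ xs) = EdgeIn E a b × Chain E (b ∷ xs)

HasCycle : ∀ {n} → List (Vertex n × Vertex n) → Set
HasCycle {n} E =
  Σ (Vertex n) λ a → Σ (Vertex n) λ b → Σ (Vertex n) λ c → Σ (List (Vertex n)) λ rest →
    Unique (a ∷ b ∷ c ∷ rest) × Chain E (a ∷ b ∷ c ∷ rest ++ [ a ])

IsTree : (n : ℕ) → Subgraph n → Set
IsTree n T =
    (∀ {u v} → (u , v) ∈ edges T → Adjacent n u v × u ∈ verts T × v ∈ verts T)
  × (∀ {u v} → u ∈ verts T → v ∈ verts T → Walk (edges T) u v)
  × ¬ HasCycle (edges T)

InternallyDisjointTrees : (n m : ℕ) → List (Vertex n) → (Fin m → Subgraph n) → Set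
InternallyDisjointTrees n m S T =
    (∀ i → IsTree n (T i))
  × (∀ i {s} → s ∈ S → s ∈ verts (T i))
  × (∀ i j → i ≢ j → ∀ {u v} → EdgeIn (edges (T i)) u v → ¬ EdgeIn (edges (T j)) u v)
  × (∀ i j → i ≢ j → ∀ {v} → v ∈ verts (T i) → v ∈ verts (T j) → v ∈ S)

{-# OPTIONS --safe #-}
module Submission where

-- Write a vertex as (a , b , c) with a, b in the cube Q of dimension m = n - 1; a class 0
-- cluster fixes b, a class 1 cluster fixes a, and any two clusters of different
-- classes are joined by exactly one edge.  Let x = (xa , β , 0) and y = (ya , β , 0) be the
-- two vertices in a common cluster.  The tool is the fan: for u and c in Q there are m
-- connected sets containing u, pairwise meeting only in u, the i-th of which
-- contains the i-th neighbour c + eᵢ of c.  The fan from ya to the neighbours of xa,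
-- together with xa, joins x and y in m ways.  Part i leaves their cluster at
-- (xa + eᵢ , β , 0), crosses to the class 1 cluster of xa + eᵢ, from there reaches
-- whole clusters ("hubs") that belong to part i alone, and enters the clusters of z and w
-- along fans ending in z and w.  Part i is then thinned to a tree by adding leaves.

open import Defs
open import Data.Nat using (ℕ; zero; suc; _+_; _∸_; _≤_; z≤n; s≤s)
open import Data.Nat.Properties using
  (+-suc; +-identityʳ; +-monoʳ-≤; m≤m+n; n≤1+n; ≤-trans; ≤-reflexive)
open import Data.Bool using (Bool; true; false; not)
open import Data.Bool.Properties using (¬-not; not-involutive)
import Data.Bool.Properties as Bool
open import Data.Fin using (Fin; zero; suc; toℕ)
open import Data.Fin.Properties using (any?; toℕ<n)
import Data.Fin.Properties as Fin
open import Data.List using (List; []; _∷_; _++_; [_]; map; length; deduplicate; applyUpTo)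
open import Data.List.Properties using (map-∘; map-cong; map-id; map-upTo; map-applyUpTo)
open import Data.List.Membership.Propositional using (_∈_)
open import Data.List.Membership.Propositional.Properties using (∈-map⁺; ∈-map⁻)
import Data.List.Membership.DecPropositional as DecMembership
open import Data.List.Relation.Binary.Permutation.Propositional as ↭ using (_↭_; ↭-refl; ↭-sym; ↭-trans)
open import Data.List.Relation.Binary.Permutation.Propositional.Properties using (∈-resp-↭; shift; ++-comm)
open import Data.List.Relation.Unary.All as All using (All; []; _∷_)
import Data.List.Relation.Unary.All.Properties as All
open import Data.List.Relation.Unary.AllPairs using ([]; _∷_)
open import Data.List.Relation.Unary.Any using (here; there)
open import Data.List.Relation.Unary.Unique.Propositional using (Unique)
open import Data.Vec as Vec using (Vec; []; _∷_; toList; splitAt; updateAt)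
open import Data.Vec.Properties using
  (≡-dec; ∷-injectiveˡ; ∷-injectiveʳ; ++-injective; cast-is-id; toList-injective)
open import Data.Product as Product using (Σ; ∃; _×_; _,_; proj₁; proj₂)
open import Data.Sum as Sum using (_⊎_; inj₁; inj₂)
open import Data.Unit using (⊤; tt)
open import Data.Empty using (⊥; ⊥-elim)
open import Function using (_∘_; id)
open import Relation.Nullary using (¬_; yes; no; contradiction)
open import Relation.Nullary.Decidable using (map′)
open import Relation.Binary.Definitions using (DecidableEquality)
open import Relation.Binary.PropositionalEquality using
  (_≡_; _≢_; refl; sym; trans; cong; cong₂; subst; subst₂)
open import Relation.Binary.Construct.Closure.ReflexiveTransitive using (Star; ε; _◅_; _◅◅_; gmap; reverse)

-- Cubes and walks confined to a set of vertices.

Cube : ℕ → Set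
Cube = Vec Bool

private variable
  m : ℕ

_≟Q_ : DecidableEquality (Cube m)
_≟Q_ = ≡-dec Bool._≟_

flip : Fin m → Cube m → Cube m
flip i u = updateAt u i not

not≢ : ∀ b → not b ≢ b
not≢ true ()
not≢ false ()

flip-involutive : ∀ (i : Fin m) u → flip i (flip i u) ≡ u
flip-involutive zero    (b ∷ u) = cong (_∷ u) (not-involutive b)
flip-involutive (suc i) (b ∷ u) = cong (b ∷_) (flip-involutive i u)

flip≢ : ∀ (i : Fin m) u → flip i u ≢ u
flip≢ zero    (b ∷ u) e = not≢ b (∷-injectiveˡ e)
flip≢ (suc i) (b ∷ u) e = flip≢ i u (∷-injectiveʳ e)

flip-injective : ∀ (i j : Fin m) u → flip i u ≡ flip j u → i ≡ j
flip-injective zero    zero    u       e = refl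
flip-injective zero    (suc j) (b ∷ u) e = contradiction (∷-injectiveˡ e) (not≢ b)
flip-injective (suc i) zero    (b ∷ u) e = contradiction (sym (∷-injectiveˡ e)) (not≢ b)
flip-injective (suc i) (suc j) (b ∷ u) e = cong suc (flip-injective i j u (∷-injectiveʳ e))

-- Membership is attached to the steps, so an empty walk says nothing about its vertex. This is why
-- a `Fan` carries `source` as a separate field.
StepIn : (Cube m → Set) → Cube m → Cube m → Set
StepIn F u v = F u × F v × ∃ λ i → v ≡ flip i u

WalkIn : (Cube m → Set) → Cube m → Cube m → Set
WalkIn F = Star (StepIn F)

cube-connected : (u v : Cube m) → WalkIn (λ _ → ⊤) u v
cube-connected []      []      = ε
cube-connected (p ∷ u) (q ∷ v) = firstBit (p Bool.≟ q) ◅◅ gmap (q ∷_) lift (cube-connected u v)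
  where
  lift : ∀ {u v} → StepIn (λ _ → ⊤) u v → StepIn (λ _ → ⊤) (q ∷ u) (q ∷ v)
  lift (_ , _ , i , e) = _ , _ , suc i , cong (q ∷_) e
  firstBit : _ → WalkIn (λ _ → ⊤) (p ∷ u) (q ∷ u)
  firstBit (yes refl) = ε
  firstBit (no p≢q)   = (_ , _ , zero , cong (_∷ u) (¬-not (λ e → p≢q (sym e)))) ◅ ε

-- Fans, built by induction on the dimension.

-- m connected sets around u, meeting only in u, the i-th of which reaches the
-- i-th neighbour of c: what is left of m internally disjoint u-c paths after
-- deleting c.
record Fan (u c : Cube m) : Set₁ where
  field
    Arm      : Fin m → Cube m → Set
    source   : ∀ i → Arm i u
    walk     : ∀ i → WalkIn (Arm i) u (flip i c)
    disjoint : ∀ {i j v} → i ≢ j → Arm i v → Arm j v → v ≡ u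
    avoids   : ∀ {i} → Arm i c → c ≡ u

  target : ∀ i → Arm i (flip i c)
  target i = endpoint (source i) (walk i)
    where
    endpoint : ∀ {a b} → Arm i a → WalkIn (Arm i) a b → Arm i b
    endpoint a∈ ε                    = a∈
    endpoint _  ((_ , b∈ , _) ◅ walk) = endpoint b∈ walk

prepend : ∀ {F : Cube m → Set} {G : Cube (suc m) → Set} b → (∀ {u} → F u → G (b ∷ u)) →
          ∀ {u v} → WalkIn F u v → WalkIn G (b ∷ u) (b ∷ v)
prepend b F⊆G = gmap (b ∷_) λ (u∈ , v∈ , i , e) → F⊆G u∈ , F⊆G v∈ , suc i , cong (b ∷_) e

open Fan

-- Both vertices lie in the half `p`. Arm `zero` steps from `p ∷ u` into the other half and owns all
-- of it; the remaining arms are a smaller fan inside the half `p`, so they cannot meet it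
-- elsewhere.
fan-parallel : ∀ p {u c : Cube m} → Fan u c → Fan (p ∷ u) (p ∷ c)
fan-parallel {m} p {u} {c} f = record
  { Arm = A ; source = s ; walk = w ; disjoint = λ {i} {j} → d i j ; avoids = λ {i} → a i }
  where
  A : Fin (suc m) → Cube (suc m) → Set
  A zero    (b ∷ v) = (b ∷ v ≡ p ∷ u) ⊎ (b ≡ not p)
  A (suc i) (b ∷ v) = (b ≡ p) × Arm f i v
  s : ∀ i → A i (p ∷ u)
  s zero    = inj₁ refl
  s (suc i) = refl , source f i
  w : ∀ i → WalkIn (A i) (p ∷ u) (flip i (p ∷ c))
  w zero    = (inj₁ refl , inj₂ refl , zero , refl) ◅ prepend (not p) (λ _ → inj₂ refl) (cube-connected u c)
  w (suc i) = prepend p (refl ,_) (walk f i)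
  d : ∀ i j {v} → i ≢ j → A i v → A j v → v ≡ p ∷ u
  d zero    zero    {b ∷ v} i≢j _ _ = contradiction refl i≢j
  d zero    (suc j) {b ∷ v} i≢j (inj₁ e) _ = e
  d zero    (suc j) {b ∷ v} i≢j (inj₂ refl) (e , _) = contradiction e (not≢ p)
  d (suc i) zero    {b ∷ v} i≢j _ (inj₁ e) = e
  d (suc i) zero    {b ∷ v} i≢j (e , _) (inj₂ refl) = contradiction e (not≢ p)
  d (suc i) (suc j) {b ∷ v} i≢j (refl , x) (_ , y) = cong (p ∷_) (disjoint f (λ e → i≢j (cong suc e)) x y)
  a : ∀ i → A i (p ∷ c) → p ∷ c ≡ p ∷ u
  a zero    (inj₁ e)   = e
  a zero    (inj₂ e)   = contradiction (sym e) (not≢ p)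
  a (suc i) (_ , c∈)   = cong (p ∷_) (avoids f c∈)

-- The neighbour of the centre in direction `zero` is the source itself, so that arm is a single
-- vertex. Every other arm is a path of two steps: first direction i, then across to the half of the
-- centre.
fan-adjacent : ∀ {p q} → p ≡ not q → (u : Cube m) → Fan (p ∷ u) (q ∷ u)
fan-adjacent {m} {p} {q} p≡¬q u = record
  { Arm = A ; source = s ; walk = w ; disjoint = λ {i} {j} → d i j ; avoids = λ {i} → a i }
  where
  A : Fin (suc m) → Cube (suc m) → Set
  A zero    v       = v ≡ p ∷ u
  A (suc i) (b ∷ v) = (b ∷ v ≡ p ∷ u) ⊎ (v ≡ flip i u)
  s : ∀ i → A i (p ∷ u)
  s zero    = refl
  s (suc i) = inj₁ refl
  w : ∀ i → WalkIn (A i) (p ∷ u) (flip i (q ∷ u))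
  w zero    = subst (λ b → WalkIn (A zero) (p ∷ u) (b ∷ u)) p≡¬q ε
  w (suc i) = (inj₁ refl , inj₂ refl , suc i , refl)
            ◅ (inj₂ refl , inj₂ refl , zero , cong (_∷ _) (trans (sym (not-involutive q)) (cong not (sym p≡¬q)))) ◅ ε
  d : ∀ i j {v} → i ≢ j → A i v → A j v → v ≡ p ∷ u
  d zero    j       {b ∷ v} i≢j e _ = e
  d (suc i) zero    {b ∷ v} i≢j _ e = e
  d (suc i) (suc j) {b ∷ v} i≢j (inj₁ e) _ = e
  d (suc i) (suc j) {b ∷ v} i≢j (inj₂ _) (inj₁ e) = e
  d (suc i) (suc j) {b ∷ v} i≢j (inj₂ refl) (inj₂ e) = contradiction (cong suc (flip-injective i j u e)) i≢j
  a : ∀ i → A i (q ∷ u) → q ∷ u ≡ p ∷ u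
  a zero    e        = e
  a (suc i) (inj₁ e) = e
  a (suc i) (inj₂ e) = contradiction (sym e) (flip≢ i u)

-- Arm j is used twice: in the half of u it is prolonged to p ∷ c, and its copy in
-- the half of c serves the neighbour q ∷ flip j c.  The other arms stay in the half
-- of u and cross at their last step; they miss the copy of arm j because u is
-- the neighbour of c in no direction other than j.
fan-opposite : ∀ {p q} {u c : Cube m} → p ≡ not q → u ≢ c → (j : Fin m) → (∀ i → u ≡ flip i c → i ≡ j) →
               Fan u c → Fan (p ∷ u) (q ∷ c)
fan-opposite {m} {p} {q} {u} {c} p≡¬q u≢c j only-j f = record
  { Arm = A ; source = s ; walk = w ; disjoint = λ {i} {j} → d i j ; avoids = λ {i} → a i }
  where
  q≡¬p : q ≡ not p
  q≡¬p = trans (sym (not-involutive q)) (cong not (sym p≡¬q))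
  p≢q : ∀ {b} → b ≡ p → b ≡ q → ⊥
  p≢q refl e = not≢ p (sym (trans e q≡¬p))
  A : Fin (suc m) → Cube (suc m) → Set
  A zero    (b ∷ v) = (b ≡ p × Arm f j v) ⊎ (b ∷ v ≡ p ∷ c)
  A (suc i) (b ∷ v) = (i ≡ j × (b ∷ v ≡ p ∷ u ⊎ (b ≡ q × Arm f j v)))
                    ⊎ (i ≢ j × ((b ≡ p × Arm f i v) ⊎ (b ∷ v ≡ q ∷ flip i c)))
  s : ∀ i → A i (p ∷ u)
  s zero    = inj₁ (refl , source f j)
  s (suc i) with i Fin.≟ j
  ... | yes i≡j = inj₁ (i≡j , inj₁ refl)
  ... | no  i≢j = inj₂ (i≢j , inj₁ (refl , source f i))
  w : ∀ i → WalkIn (A i) (p ∷ u) (flip i (q ∷ c))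
  w zero    = subst (λ b → WalkIn (A zero) (p ∷ u) (b ∷ c)) p≡¬q
    (prepend p (λ v∈ → inj₁ (refl , v∈)) (walk f j)
      ◅◅ (inj₁ (refl , target f j) , inj₂ refl , suc j , cong (p ∷_) (sym (flip-involutive j c))) ◅ ε)
  w (suc i) with i Fin.≟ j
  ... | yes refl = (inj₁ (refl , inj₁ refl) , inj₁ (refl , inj₂ (refl , source f j)) , zero , cong (_∷ u) q≡¬p)
                 ◅ prepend q (λ v∈ → inj₁ (refl , inj₂ (refl , v∈))) (walk f j)
  ... | no  i≢j  = prepend p (λ v∈ → inj₂ (i≢j , inj₁ (refl , v∈))) (walk f i)
                 ◅◅ (inj₂ (i≢j , inj₁ (refl , target f i)) , inj₂ (i≢j , inj₂ refl) , zero , cong (_∷ _) q≡¬p) ◅ ε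
  d< : ∀ i {v} → A zero v → A (suc i) v → v ≡ p ∷ u
  d< i {b ∷ v} _ (inj₁ (_ , inj₁ e)) = e
  d< i {b ∷ v} (inj₁ (e , _)) (inj₁ (_ , inj₂ (e′ , _))) = ⊥-elim (p≢q e e′)
  d< i {b ∷ v} (inj₂ e) (inj₁ (_ , inj₂ (e′ , _))) = ⊥-elim (p≢q (∷-injectiveˡ e) e′)
  d< i {b ∷ v} (inj₁ (refl , x)) (inj₂ (i≢j , inj₁ (_ , y))) = cong (p ∷_) (disjoint f i≢j y x)
  -- The vertex `p ∷ c` was appended to arm `zero`; the other arms miss it because the arms of `f`
  -- avoid `c`, given `u ≢ c`.
  d< i {b ∷ v} (inj₂ refl) (inj₂ (i≢j , inj₁ (_ , y))) = contradiction (sym (avoids f y)) u≢c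
  d< i {b ∷ v} (inj₁ (e , _)) (inj₂ (_ , inj₂ e′)) = ⊥-elim (p≢q e (∷-injectiveˡ e′))
  d< i {b ∷ v} (inj₂ e) (inj₂ (_ , inj₂ e′)) = ⊥-elim (p≢q (∷-injectiveˡ e) (∷-injectiveˡ e′))
  dj : ∀ i k {v} → i ≡ j → k ≢ j → A (suc i) v → A (suc k) v → v ≡ p ∷ u
  dj i k {b ∷ v} i≡j k≢j (inj₂ (i≢j , _)) _ = contradiction i≡j i≢j
  dj i k {b ∷ v} i≡j k≢j _ (inj₁ (k≡j , _)) = contradiction k≡j k≢j
  dj i k {b ∷ v} i≡j k≢j (inj₁ (_ , inj₁ e)) _ = e
  dj i k {b ∷ v} i≡j k≢j (inj₁ (_ , inj₂ (e , _))) (inj₂ (_ , inj₁ (e′ , _))) = ⊥-elim (p≢q e′ e)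
  -- Here `flip k c` ends arm k of `f` and also lies on arm j, so it equals `u`; then `only-j`
  -- forces k to be j.
  dj i k {b ∷ v} i≡j k≢j (inj₁ (_ , inj₂ (e , x))) (inj₂ (_ , inj₂ refl)) =
    contradiction (only-j k (sym (disjoint f k≢j (target f k) x))) k≢j
  d : ∀ i j {v} → i ≢ j → A i v → A j v → v ≡ p ∷ u
  d zero    zero    {b ∷ v} i≢k _ _ = contradiction refl i≢k
  d zero    (suc k) {b ∷ v} i≢k x y = d< k x y
  d (suc i) zero    {b ∷ v} i≢k x y = d< i y x
  d (suc i) (suc k) {b ∷ v} i≢k x y with i Fin.≟ j | k Fin.≟ j
  ... | yes i≡j | yes k≡j = contradiction (cong suc (trans i≡j (sym k≡j))) i≢k
  ... | yes i≡j | no  k≢j = dj i k i≡j k≢j x y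
  ... | no  i≢j | yes k≡j = dj k i k≡j i≢j y x
  d (suc i) (suc k) {b ∷ v} i≢k (inj₁ (e , _)) _ | no i≢j | no k≢j = contradiction e i≢j
  d (suc i) (suc k) {b ∷ v} i≢k (inj₂ _) (inj₁ (e , _)) | no i≢j | no k≢j = contradiction e k≢j
  d (suc i) (suc k) {b ∷ v} i≢k (inj₂ (_ , inj₁ (refl , x))) (inj₂ (_ , inj₁ (_ , y))) | no i≢j | no k≢j =
    cong (p ∷_) (disjoint f (λ e → i≢k (cong suc e)) x y)
  d (suc i) (suc k) {b ∷ v} i≢k (inj₂ (_ , inj₁ (e , x))) (inj₂ (_ , inj₂ e′)) | no i≢j | no k≢j =
    ⊥-elim (p≢q e (∷-injectiveˡ e′))
  d (suc i) (suc k) {b ∷ v} i≢k (inj₂ (_ , inj₂ e′)) (inj₂ (_ , inj₁ (e , x))) | no i≢j | no k≢j =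
    ⊥-elim (p≢q e (∷-injectiveˡ e′))
  d (suc i) (suc k) {b ∷ v} i≢k (inj₂ (_ , inj₂ refl)) (inj₂ (_ , inj₂ e)) | no i≢j | no k≢j =
    contradiction (cong suc (flip-injective i k c (∷-injectiveʳ e))) i≢k
  a : ∀ i → A i (q ∷ c) → q ∷ c ≡ p ∷ u
  a zero    (inj₁ (e , _)) = ⊥-elim (p≢q e refl)
  a zero    (inj₂ e) = ⊥-elim (p≢q (∷-injectiveˡ e) refl)
  a (suc i) (inj₁ (_ , inj₁ e)) = e
  a (suc i) (inj₁ (_ , inj₂ (_ , x))) = contradiction (sym (avoids f x)) u≢c
  a (suc i) (inj₂ (_ , inj₁ (e , _))) = ⊥-elim (p≢q e refl)
  a (suc i) (inj₂ (_ , inj₂ e)) = contradiction (sym (∷-injectiveʳ e)) (flip≢ i c)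

-- At most one direction leads from `c` to `u`. If there is one it must be chosen; otherwise any
-- direction serves, and `u ≢ c` ensures that the dimension is positive.
crossing-direction : (u c : Cube m) → u ≢ c → ∃ λ j → ∀ i → u ≡ flip i c → i ≡ j
crossing-direction u c u≢c with any? (λ j → u ≟Q flip j c)
crossing-direction u c u≢c | yes (j , e) = j , λ i e′ → flip-injective i j c (trans (sym e′) e)
crossing-direction []      []      u≢c | no _  = contradiction refl u≢c
crossing-direction (_ ∷ _) (_ ∷ _) u≢c | no ∄j = zero , λ i e → contradiction (i , e) ∄j

fan : (u c : Cube m) → Fan u c
fan []      []      = record
  { Arm = λ _ _ → ⊤ ; source = λ () ; walk = λ () ; disjoint = λ { {()} } ; avoids = λ _ → refl }
fan (p ∷ u) (q ∷ c) with p Bool.≟ q | u ≟Q c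
... | yes refl | _        = fan-parallel p (fan u c)
... | no  p≢q  | yes refl = fan-adjacent (¬-not p≢q) u
... | no  p≢q  | no  u≢c  =
  let j , only-j = crossing-direction u c u≢c in fan-opposite (¬-not p≢q) u≢c j only-j (fan u c)

-- The dual cube in coordinates, and systems of parts.

Node : ℕ → Set
Node m = Cube m × Cube m × Bool

data Adj {m} : Node m → Node m → Set where
  move₀ : ∀ {a b} i → Adj (a , b , false) (flip i a , b , false)
  move₁ : ∀ {a b} i → Adj (a , b , true) (a , flip i b , true)
  cross : ∀ {a b} c → Adj (a , b , c) (a , b , not c)

adj-sym : {u v : Node m} → Adj u v → Adj v u
adj-sym (move₀ {a} {b} i) =
  subst (λ a′ → Adj (flip i a , b , false) (a′ , b , false)) (flip-involutive i a) (move₀ i)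
adj-sym (move₁ {a} {b} i) =
  subst (λ b′ → Adj (a , flip i b , true) (a , b′ , true)) (flip-involutive i b) (move₁ i)
adj-sym (cross {a} {b} c) =
  subst (λ c′ → Adj (a , b , not c) (a , b , c′)) (not-involutive c) (cross (not c))

module Linked {m} (S : Node m → Set) (Part : Fin m → Node m → Set) (Exempt : Fin m → Set) where

  -- Distinct parts may both contain both ends of an edge inside `S`. The last component withholds
  -- such edges from all parts that are not exempt.
  Link : Fin m → Node m → Node m → Set
  Link i u v = Adj u v × Part i u × Part i v × (Exempt i ⊎ ¬ (S u × S v))

  link-sym : ∀ {i u v} → Link i u v → Link i v u
  link-sym (uv , u∈ , v∈ , ok) = adj-sym uv , v∈ , u∈ , Sum.map₂ (λ ¬S (v , u) → ¬S (u , v)) ok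

  -- If `F` contains at most one vertex of `S`, no step of a walk in `F` has both ends in `S`, since
  -- a flip changes the vertex; so no exemption is required.
  embed : ∀ {i} (ι : Cube m → Node m) → (∀ k a → Adj (ι a) (ι (flip k a))) →
          ∀ {F : Cube m → Set} → (∀ {a} → F a → Part i (ι a)) →
          (∀ {a b} → F a → F b → S (ι a) → S (ι b) → a ≡ b) →
          ∀ {u v} → WalkIn F u v → Star (Link i) (ι u) (ι v)
  embed ι adj F⊆ S-unique = gmap ι λ { (u∈ , v∈ , k , refl) →
    adj k _ , F⊆ u∈ , F⊆ v∈ , inj₂ λ (su , sv) → flip≢ k _ (sym (S-unique u∈ v∈ su sv)) }

  walk₀ : ∀ {i b} {F : Cube m → Set} → (∀ {a} → F a → Part i (a , b , false)) →
          (∀ {a a′} → F a → F a′ → S (a , b , false) → S (a′ , b , false) → a ≡ a′) →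
          ∀ {u v} → WalkIn F u v → Star (Link i) (u , b , false) (v , b , false)
  walk₀ = embed (λ a → a , _ , false) (λ k _ → move₀ k)

  walk₁ : ∀ {i a} {F : Cube m → Set} → (∀ {b} → F b → Part i (a , b , true)) →
          (∀ {b b′} → F b → F b′ → S (a , b , true) → S (a , b′ , true) → b ≡ b′) →
          ∀ {u v} → WalkIn F u v → Star (Link i) (a , u , true) (a , v , true)
  walk₁ = embed (λ b → _ , b , true) (λ k _ → move₁ k)

  hub₀ : ∀ {i b} → (∀ {a} → Part i (a , b , false)) → (∀ {a} → ¬ S (a , b , false)) →
         ∀ u v → Star (Link i) (u , b , false) (v , b , false)
  hub₀ P ¬S u v = walk₀ (λ _ → P) (λ _ _ s → ⊥-elim (¬S s)) (cube-connected u v)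

  hub₁ : ∀ {i a} → (∀ {b} → Part i (a , b , true)) → (∀ {b} → ¬ S (a , b , true)) →
         ∀ u v → Star (Link i) (a , u , true) (a , v , true)
  hub₁ P ¬S u v = walk₁ (λ _ → P) (λ _ _ s → ⊥-elim (¬S s)) (cube-connected u v)

-- Two parts can only share an edge between vertices of S; at most one part, the exempt
-- one, may use such an edge.
record System {m} (S : Node m → Set) (root : Node m) : Set₁ where
  field
    Part          : Fin m → Node m → Set
    Exempt        : Fin m → Set
    exempt-unique : ∀ {i j} → Exempt i → Exempt j → i ≡ j
    root∈         : ∀ i → Part i root
    meet          : ∀ {i j} → i ≢ j → ∀ v → Part i v → Part j v → S v
  open Linked S Part Exempt public
  field
    connected     : ∀ i {s} → S s → Star (Link i) root s

-- The common cluster of x and y.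

module Trunk {m} (xa ya β : Cube m) (x≢y : xa ≢ ya) where

  fy : Fan ya xa
  fy = fan ya xa

  Trunk : Fin m → Cube m → Set
  Trunk i a = Arm fy i a ⊎ a ≡ xa

  -- When x and y are adjacent, the step from `xa` in one direction is the edge xy itself. Only the
  -- part of that direction is allowed an edge inside `S`.
  Exempt : Fin m → Set
  Exempt i = flip i xa ≡ ya

  exempt-unique : ∀ {i j} → Exempt i → Exempt j → i ≡ j
  exempt-unique {i} {j} e e′ = flip-injective i j xa (trans e (sym e′))

  trunk-meet : ∀ {i j a} → i ≢ j → Trunk i a → Trunk j a → a ≡ xa ⊎ a ≡ ya
  trunk-meet i≢j (inj₂ e)  _         = inj₁ e
  trunk-meet i≢j (inj₁ _)  (inj₂ e)  = inj₁ e
  trunk-meet i≢j (inj₁ a∈) (inj₁ a∈′) = inj₂ (disjoint fy i≢j a∈ a∈′)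

  module _ (S : Node m → Set) (Part : Fin m → Node m → Set)
           (trunk⊆ : ∀ {i a} → Trunk i a → Part i (a , β , false))
           (S-trunk : ∀ {a} → S (a , β , false) → a ≡ xa ⊎ a ≡ ya) where
    open Linked S Part Exempt

    neighbour∉S : ∀ i → Exempt i ⊎ ¬ S (flip i xa , β , false)
    neighbour∉S i with flip i xa ≟Q ya
    ... | yes e = inj₁ e
    ... | no ne = inj₂ λ s → Sum.[ flip≢ i xa , ne ] (S-trunk s)

    to-neighbour : ∀ i → Star (Link i) (xa , β , false) (flip i xa , β , false)
    to-neighbour i =
      (move₀ i , trunk⊆ (inj₂ refl) , trunk⊆ (inj₁ (target fy i)) ,
       Sum.map₂ (λ ∉S (_ , s) → ∉S s) (neighbour∉S i)) ◅ ε

    to-y : ∀ i → Star (Link i) (xa , β , false) (ya , β , false)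
    to-y i = to-neighbour i ◅◅ reverse link-sym
      (walk₀ (λ a∈ → trunk⊆ (inj₁ a∈)) (λ u∈ v∈ su sv → trans (only-y u∈ su) (sym (only-y v∈ sv))) (walk fy i))
      where
      -- Arms avoid `xa`, so y is the only vertex of `S` on an arm, as `walk₀` requires.
      only-y : ∀ {a} → Arm fy i a → S (a , β , false) → a ≡ ya
      only-y a∈ s with S-trunk s
      ... | inj₁ refl = contradiction (avoids fy a∈) x≢y
      ... | inj₂ e    = e

-- The three configurations, by the classes of the clusters of z and w.

-- With z and w in class 0, the hub of part i is the class 1 cluster of `flip i xa`. Its edges to
-- the clusters of z and w end at first coordinate `flip i xa`; hence the fans of z and w are
-- centred at `xa` too.
system₀₀ : (xa ya za wa β β₁ β₂ : Cube m) → xa ≢ ya → β ≢ β₁ → β ≢ β₂ → β₁ ≢ β₂ →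
  System (_∈ (xa , β , false) ∷ (ya , β , false) ∷ (za , β₁ , false) ∷ (wa , β₂ , false) ∷ []) (xa , β , false)
system₀₀ {m} xa ya za wa β β₁ β₂ x≢y β≢β₁ β≢β₂ β₁≢β₂ = record
  { Part = P ; Exempt = Exempt ; exempt-unique = exempt-unique ; root∈ = λ i → inj₁ (refl , inj₂ refl)
  ; meet = meet ; connected = conn }
  where
  open Trunk xa ya β x≢y
  fz = fan za xa
  fw = fan wa xa
  S : Node m → Set
  S = _∈ (xa , β , false) ∷ (ya , β , false) ∷ (za , β₁ , false) ∷ (wa , β₂ , false) ∷ []
  P : Fin m → Node m → Set
  P i (a , b , false) = (b ≡ β × Trunk i a) ⊎ (b ≡ β₁ × Arm fz i a) ⊎ (b ≡ β₂ × Arm fw i a)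
  P i (a , b , true)  = a ≡ flip i xa
  meet : ∀ {i j} → i ≢ j → ∀ v → P i v → P j v → S v
  meet i≢j (a , b , true) refl e = contradiction (flip-injective _ _ xa e) i≢j
  meet i≢j (a , b , false) (inj₁ (refl , t)) (inj₁ (_ , t′)) with trunk-meet i≢j t t′
  ... | inj₁ refl = here refl
  ... | inj₂ refl = there (here refl)
  meet i≢j (a , b , false) (inj₁ (refl , _)) (inj₂ (inj₁ (e , _))) = contradiction e β≢β₁
  meet i≢j (a , b , false) (inj₁ (refl , _)) (inj₂ (inj₂ (e , _))) = contradiction e β≢β₂
  meet i≢j (a , b , false) (inj₂ (inj₁ (refl , _))) (inj₁ (e , _)) = contradiction (sym e) β≢β₁
  meet i≢j (a , b , false) (inj₂ (inj₁ (refl , t))) (inj₂ (inj₁ (_ , t′)))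
    rewrite disjoint fz i≢j t t′ = there (there (here refl))
  meet i≢j (a , b , false) (inj₂ (inj₁ (refl , _))) (inj₂ (inj₂ (e , _))) = contradiction e β₁≢β₂
  meet i≢j (a , b , false) (inj₂ (inj₂ (refl , _))) (inj₁ (e , _)) = contradiction (sym e) β≢β₂
  meet i≢j (a , b , false) (inj₂ (inj₂ (refl , _))) (inj₂ (inj₁ (e , _))) = contradiction (sym e) β₁≢β₂
  meet i≢j (a , b , false) (inj₂ (inj₂ (refl , t))) (inj₂ (inj₂ (_ , t′)))
    rewrite disjoint fw i≢j t t′ = there (there (there (here refl)))
  S-x : ∀ {a} → S (a , β , false) → a ≡ xa ⊎ a ≡ ya
  S-x (here refl) = inj₁ refl
  S-x (there (here refl)) = inj₂ refl
  S-x (there (there (here refl))) = contradiction refl β≢β₁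
  S-x (there (there (there (here refl)))) = contradiction refl β≢β₂
  S-z : ∀ {a} → S (a , β₁ , false) → a ≡ za
  S-z (here refl) = contradiction refl β≢β₁
  S-z (there (here refl)) = contradiction refl β≢β₁
  S-z (there (there (here refl))) = refl
  S-z (there (there (there (here refl)))) = contradiction refl β₁≢β₂
  S-w : ∀ {a} → S (a , β₂ , false) → a ≡ wa
  S-w (here refl) = contradiction refl β≢β₂
  S-w (there (here refl)) = contradiction refl β≢β₂
  S-w (there (there (here refl))) = contradiction refl β₁≢β₂
  S-w (there (there (there (here refl)))) = refl
  S-true : ∀ {a b} → ¬ S (a , b , true)
  S-true (there (there (there (there ()))))
  open Linked S P Exempt
  trunk⊆ : ∀ {i a} → Trunk i a → P i (a , β , false)
  trunk⊆ t = inj₁ (refl , t)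
  to-hub : ∀ i b → Star (Link i) (xa , β , false) (flip i xa , b , true)
  to-hub i b = to-neighbour S P trunk⊆ S-x i
    ◅◅ (cross false , trunk⊆ (inj₁ (target fy i)) , refl , inj₂ (λ (_ , s) → S-true s))
    ◅ hub₁ refl S-true β b
  conn : ∀ i {s} → S s → Star (Link i) (xa , β , false) s
  conn i (here refl) = ε
  conn i (there (here refl)) = to-y S P trunk⊆ S-x i
  conn i (there (there (here refl))) = to-hub i β₁
    ◅◅ (cross true , refl , inj₂ (inj₁ (refl , target fz i)) , inj₂ (λ (s , _) → S-true s))
    ◅ reverse link-sym (walk₀ (λ t → inj₂ (inj₁ (refl , t))) (λ _ _ s s′ → trans (S-z s) (sym (S-z s′))) (walk fz i))
  conn i (there (there (there (here refl)))) = to-hub i β₂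
    ◅◅ (cross true , refl , inj₂ (inj₂ (refl , target fw i)) , inj₂ (λ (s , _) → S-true s))
    ◅ reverse link-sym (walk₀ (λ t → inj₂ (inj₂ (refl , t))) (λ _ _ s s′ → trans (S-w s) (sym (S-w s′))) (walk fw i))

-- With z in class 0 and w in class 1, part i has two hubs: a class 1 cluster, adjacent to the
-- cluster of z, and the class 0 cluster of `flip i c`, through which w is reached. The conditions
-- on `c` keep the class 0 hubs away from the clusters of x and z, and the fan of w is centred at
-- `c` so that arm i starts where this hub is left.
system₀₁ : (xa ya za wa β β₁ wb c : Cube m) → xa ≢ ya → β ≢ β₁ →
  (∀ i → flip i c ≢ β) → (∀ i → flip i c ≢ β₁) →
  System (_∈ (xa , β , false) ∷ (ya , β , false) ∷ (za , β₁ , false) ∷ (wa , wb , true) ∷ []) (xa , β , false)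
system₀₁ {m} xa ya za wa β β₁ wb c x≢y β≢β₁ γ≢β γ≢β₁ = record
  { Part = P ; Exempt = Exempt ; exempt-unique = exempt-unique ; root∈ = λ i → inj₁ (refl , inj₂ refl)
  ; meet = meet ; connected = conn }
  where
  open Trunk xa ya β x≢y
  fz = fan za xa
  fw = fan wb c
  γ : Fin m → Cube m
  γ i = flip i c
  -- The class 1 cluster of w must not serve as a hub, hence the detour through xa.
  hub : Fin m → Cube m
  hub i with flip i xa ≟Q wa
  ... | yes _ = xa
  ... | no _  = flip i xa
  -- A part that detours enters the cluster of z at `xa`, so its arm is prolonged from `flip i xa`
  -- to `xa`. The arms of `fz` avoid `xa` unless it is `za`, and at most one part detours.
  ArmZ : Fin m → Cube m → Set
  ArmZ i a = Arm fz i a ⊎ (flip i xa ≡ wa × a ≡ xa)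
  hub≢wa : ∀ i → hub i ≢ wa
  hub≢wa i e with flip i xa ≟Q wa
  ... | yes e′ = flip≢ i xa (trans e′ (sym e))
  ... | no ne  = ne e
  hub-injective : ∀ i j → hub i ≡ hub j → i ≡ j
  hub-injective i j e with flip i xa ≟Q wa | flip j xa ≟Q wa
  ... | yes p | yes q = flip-injective i j xa (trans p (sym q))
  ... | yes p | no q  = contradiction (sym e) (flip≢ j xa)
  ... | no p  | yes q = contradiction e (flip≢ i xa)
  ... | no p  | no q  = flip-injective i j xa e
  hub∈trunk : ∀ i → Trunk i (hub i)
  hub∈trunk i with flip i xa ≟Q wa
  ... | yes _ = inj₂ refl
  ... | no _  = inj₁ (target fy i)
  hub∈Z : ∀ i → ArmZ i (hub i)
  hub∈Z i with flip i xa ≟Q wa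
  ... | yes e = inj₂ (e , refl)
  ... | no _  = inj₁ (target fz i)
  walkZ : ∀ i → WalkIn (ArmZ i) za (hub i)
  walkZ i with flip i xa ≟Q wa
  ... | yes e = gmap (λ a → a) (λ (u∈ , v∈ , s) → inj₁ u∈ , inj₁ v∈ , s) (walk fz i)
              ◅◅ (inj₁ (target fz i) , inj₂ (e , refl) , i , sym (flip-involutive i xa)) ◅ ε
  ... | no _  = gmap (λ a → a) (λ (u∈ , v∈ , s) → inj₁ u∈ , inj₁ v∈ , s) (walk fz i)
  meetZ : ∀ {i j a} → i ≢ j → ArmZ i a → ArmZ j a → a ≡ za
  meetZ i≢j (inj₁ t) (inj₁ t′) = disjoint fz i≢j t t′
  meetZ i≢j (inj₁ t) (inj₂ (_ , refl)) = avoids fz t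
  meetZ i≢j (inj₂ (_ , refl)) (inj₁ t) = avoids fz t
  meetZ i≢j (inj₂ (e , _)) (inj₂ (e′ , _)) = contradiction (flip-injective _ _ xa (trans e (sym e′))) i≢j
  S : Node m → Set
  S = _∈ (xa , β , false) ∷ (ya , β , false) ∷ (za , β₁ , false) ∷ (wa , wb , true) ∷ []
  P : Fin m → Node m → Set
  P i (a , b , false) = (b ≡ β × Trunk i a) ⊎ (b ≡ β₁ × ArmZ i a) ⊎ b ≡ γ i
  P i (a , b , true)  = a ≡ hub i ⊎ (a ≡ wa × Arm fw i b)
  meet : ∀ {i j} → i ≢ j → ∀ v → P i v → P j v → S v
  meet i≢j (a , b , false) (inj₁ (refl , t)) (inj₁ (_ , t′)) with trunk-meet i≢j t t′
  ... | inj₁ refl = here refl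
  ... | inj₂ refl = there (here refl)
  meet i≢j (a , b , false) (inj₁ (refl , _)) (inj₂ (inj₁ (e , _))) = contradiction e β≢β₁
  meet i≢j (a , b , false) (inj₁ (refl , _)) (inj₂ (inj₂ e)) = contradiction (sym e) (γ≢β _)
  meet i≢j (a , b , false) (inj₂ (inj₁ (refl , _))) (inj₁ (e , _)) = contradiction (sym e) β≢β₁
  meet i≢j (a , b , false) (inj₂ (inj₁ (refl , t))) (inj₂ (inj₁ (_ , t′)))
    rewrite meetZ i≢j t t′ = there (there (here refl))
  meet i≢j (a , b , false) (inj₂ (inj₁ (refl , _))) (inj₂ (inj₂ e)) = contradiction (sym e) (γ≢β₁ _)
  meet i≢j (a , b , false) (inj₂ (inj₂ refl)) (inj₁ (e , _)) = contradiction e (γ≢β _)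
  meet i≢j (a , b , false) (inj₂ (inj₂ refl)) (inj₂ (inj₁ (e , _))) = contradiction e (γ≢β₁ _)
  meet i≢j (a , b , false) (inj₂ (inj₂ refl)) (inj₂ (inj₂ e)) = contradiction (flip-injective _ _ c e) i≢j
  meet i≢j (a , b , true) (inj₁ refl) (inj₁ e) = contradiction (hub-injective _ _ e) i≢j
  meet i≢j (a , b , true) (inj₁ refl) (inj₂ (e , _)) = contradiction e (hub≢wa _)
  meet i≢j (a , b , true) (inj₂ (e , _)) (inj₁ refl) = contradiction e (hub≢wa _)
  meet i≢j (a , b , true) (inj₂ (refl , t)) (inj₂ (_ , t′))
    rewrite disjoint fw i≢j t t′ = there (there (there (here refl)))
  S-x : ∀ {a} → S (a , β , false) → a ≡ xa ⊎ a ≡ ya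
  S-x (here refl) = inj₁ refl
  S-x (there (here refl)) = inj₂ refl
  S-x (there (there (here refl))) = contradiction refl β≢β₁
  S-x (there (there (there (there ()))))
  S-z : ∀ {a} → S (a , β₁ , false) → a ≡ za
  S-z (here refl) = contradiction refl β≢β₁
  S-z (there (here refl)) = contradiction refl β≢β₁
  S-z (there (there (here refl))) = refl
  S-z (there (there (there (there ()))))
  S-γ : ∀ {i a} → ¬ S (a , γ i , false)
  -- The second coordinate is generalised to a variable, which matching on the membership proof then
  -- instantiates.
  S-γ s = elim s refl
    where
    elim : ∀ {i a b} → S (a , b , false) → γ i ≢ b
    elim (here refl) = γ≢β _
    elim (there (here refl)) = γ≢β _
    elim (there (there (here refl))) = γ≢β₁ _
    elim (there (there (there (there ()))))
  S-w : ∀ {a b} → S (a , b , true) → a ≡ wa × b ≡ wb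
  S-w (there (there (there (here refl)))) = refl , refl
  S-w (there (there (there (there ()))))
  S-hub : ∀ {i b} → ¬ S (hub i , b , true)
  S-hub s = hub≢wa _ (proj₁ (S-w s))
  open Linked S P Exempt
  trunk⊆ : ∀ {i a} → Trunk i a → P i (a , β , false)
  trunk⊆ t = inj₁ (refl , t)
  to-hub₀ : ∀ i → Star (Link i) (xa , β , false) (hub i , β , false)
  to-hub₀ i with flip i xa ≟Q wa
  ... | yes _ = ε
  ... | no _  = to-neighbour S P trunk⊆ S-x i
  to-hub : ∀ i b → Star (Link i) (xa , β , false) (hub i , b , true)
  to-hub i b = to-hub₀ i
    ◅◅ (cross false , trunk⊆ (hub∈trunk i) , inj₁ refl , inj₂ (λ (_ , s) → S-hub s))
    ◅ hub₁ (inj₁ refl) S-hub β b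
  conn : ∀ i {s} → S s → Star (Link i) (xa , β , false) s
  conn i (here refl) = ε
  conn i (there (here refl)) = to-y S P trunk⊆ S-x i
  conn i (there (there (here refl))) = to-hub i β₁
    ◅◅ (cross true , inj₁ refl , inj₂ (inj₁ (refl , hub∈Z i)) , inj₂ (λ (s , _) → S-hub s))
    ◅ reverse link-sym (walk₀ (λ t → inj₂ (inj₁ (refl , t))) (λ _ _ s s′ → trans (S-z s) (sym (S-z s′))) (walkZ i))
  -- The class 1 hub and the cluster of w are not adjacent; the class 0 hub over `γ i` joins them,
  -- and it is left at first coordinate `wa`.
  conn i (there (there (there (here refl)))) = to-hub i (γ i)
    ◅◅ (cross true , inj₁ refl , inj₂ (inj₂ refl) , inj₂ (λ (s , _) → S-hub s))
    ◅ hub₀ (inj₂ (inj₂ refl)) S-γ (hub i) wa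
    ◅◅ (cross false , inj₂ (inj₂ refl) , inj₂ (refl , target fw i) , inj₂ (λ (s , _) → S-γ s))
    ◅ reverse link-sym (walk₁ (λ t → inj₂ (refl , t))
        (λ _ _ s s′ → trans (proj₂ (S-w s)) (sym (proj₂ (S-w s′)))) (walk fw i))

-- The fans of z and w are centred at β, so they contain β + eᵢ and avoid β.  Hence
-- the two vertices used by part i in the class 1 cluster of xa + eᵢ do no harm even if
-- that cluster contains z or w.
system₁₁ : (xa ya β za zb wa wb : Cube m) → xa ≢ ya → za ≢ wa →
  System (_∈ (xa , β , false) ∷ (ya , β , false) ∷ (za , zb , true) ∷ (wa , wb , true) ∷ []) (xa , β , false)
system₁₁ {m} xa ya β za zb wa wb x≢y z≢w = record
  { Part = P ; Exempt = Exempt ; exempt-unique = exempt-unique ; root∈ = λ i → inj₁ (refl , inj₂ refl)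
  ; meet = meet ; connected = conn }
  where
  open Trunk xa ya β x≢y
  fz = fan zb β
  fw = fan wb β
  hub γ : Fin m → Cube m
  hub i = flip i xa
  γ i = flip i β
  S : Node m → Set
  S = _∈ (xa , β , false) ∷ (ya , β , false) ∷ (za , zb , true) ∷ (wa , wb , true) ∷ []
  P : Fin m → Node m → Set
  P i (a , b , false) = (b ≡ β × Trunk i a) ⊎ b ≡ γ i
  P i (a , b , true)  = (a ≡ hub i × (b ≡ β ⊎ b ≡ γ i)) ⊎ (a ≡ za × Arm fz i b) ⊎ (a ≡ wa × Arm fw i b)
  bridge-meet : ∀ {i j b s} (f : Fan s β) → i ≢ j → b ≡ β ⊎ b ≡ γ i → Arm f j b → b ≡ s
  bridge-meet f i≢j (inj₁ refl) t = avoids f t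
  bridge-meet f i≢j (inj₂ refl) t = disjoint f i≢j (target f _) t
  in-z : ∀ {a b} → a ≡ za → b ≡ zb → S (a , b , true)
  in-z refl refl = there (there (here refl))
  in-w : ∀ {a b} → a ≡ wa → b ≡ wb → S (a , b , true)
  in-w refl refl = there (there (there (here refl)))
  meet : ∀ {i j} → i ≢ j → ∀ v → P i v → P j v → S v
  meet i≢j (a , b , false) (inj₁ (refl , t)) (inj₁ (_ , t′)) with trunk-meet i≢j t t′
  ... | inj₁ refl = here refl
  ... | inj₂ refl = there (here refl)
  meet i≢j (a , b , false) (inj₁ (refl , _)) (inj₂ e) = contradiction (sym e) (flip≢ _ β)
  meet i≢j (a , b , false) (inj₂ refl) (inj₁ (e , _)) = contradiction e (flip≢ _ β)
  meet i≢j (a , b , false) (inj₂ refl) (inj₂ e) = contradiction (flip-injective _ _ β e) i≢j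
  meet i≢j (a , b , true) (inj₁ (refl , _)) (inj₁ (e , _)) = contradiction (flip-injective _ _ xa e) i≢j
  meet i≢j (a , b , true) (inj₁ (_ , r)) (inj₂ (inj₁ (e , t))) = in-z e (bridge-meet fz i≢j r t)
  meet i≢j (a , b , true) (inj₁ (_ , r)) (inj₂ (inj₂ (e , t))) = in-w e (bridge-meet fw i≢j r t)
  meet i≢j (a , b , true) (inj₂ (inj₁ (e , t))) (inj₁ (_ , r)) = in-z e (bridge-meet fz (i≢j ∘ sym) r t)
  meet i≢j (a , b , true) (inj₂ (inj₂ (e , t))) (inj₁ (_ , r)) = in-w e (bridge-meet fw (i≢j ∘ sym) r t)
  meet i≢j (a , b , true) (inj₂ (inj₁ (e , t))) (inj₂ (inj₁ (_ , t′))) = in-z e (disjoint fz i≢j t t′)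
  meet i≢j (a , b , true) (inj₂ (inj₁ (e , _))) (inj₂ (inj₂ (e′ , _))) = contradiction (trans (sym e) e′) z≢w
  meet i≢j (a , b , true) (inj₂ (inj₂ (e , _))) (inj₂ (inj₁ (e′ , _))) = contradiction (trans (sym e′) e) z≢w
  meet i≢j (a , b , true) (inj₂ (inj₂ (e , t))) (inj₂ (inj₂ (_ , t′))) = in-w e (disjoint fw i≢j t t′)
  S-false : ∀ {a b} → S (a , b , false) → b ≡ β × (a ≡ xa ⊎ a ≡ ya)
  S-false (here refl) = refl , inj₁ refl
  S-false (there (here refl)) = refl , inj₂ refl
  S-false (there (there (there (there ()))))
  S-γ : ∀ {i a} → ¬ S (a , γ i , false)
  S-γ s = flip≢ _ β (proj₁ (S-false s))
  S-unique : ∀ {a b b′} → S (a , b , true) → S (a , b′ , true) → b ≡ b′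
  S-unique (there (there (here refl))) (there (there (here refl))) = refl
  S-unique (there (there (here refl))) (there (there (there (here refl)))) = contradiction refl z≢w
  S-unique (there (there (there (here refl)))) (there (there (here refl))) = contradiction refl z≢w
  S-unique (there (there (there (here refl)))) (there (there (there (here refl)))) = refl
  S-unique (there (there (there (there ())))) _
  S-unique (there (there (here refl))) (there (there (there (there ()))))
  S-unique (there (there (there (here refl)))) (there (there (there (there ()))))
  open Linked S P Exempt
  trunk⊆ : ∀ {i a} → Trunk i a → P i (a , β , false)
  trunk⊆ t = inj₁ (refl , t)
  S-x : ∀ {a} → S (a , β , false) → a ≡ xa ⊎ a ≡ ya
  S-x = proj₂ ∘ S-false
  to-hub : ∀ i a → Star (Link i) (xa , β , false) (a , γ i , false)
  -- The crossing after this step may be an edge from y to z or w. Its class 0 end lies in `S` only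
  -- when it is y, and then part i is exempt. The next edge stays in one class 1 cluster, which
  -- holds at most one vertex of `S` because `za ≢ wa`.
  to-hub i a = to-neighbour S P trunk⊆ S-x i
    ◅◅ (cross false , trunk⊆ (inj₁ (target fy i)) , inj₁ (refl , inj₁ refl) ,
        Sum.map₂ (λ ∉S (s , _) → ∉S s) (neighbour∉S S P trunk⊆ S-x i))
    ◅ (move₁ i , inj₁ (refl , inj₁ refl) , inj₁ (refl , inj₂ refl) ,
        inj₂ (λ (s , s′) → flip≢ i β (S-unique s′ s)))
    ◅ (cross true , inj₁ (refl , inj₂ refl) , inj₂ refl , inj₂ (λ (_ , s) → S-γ s))
    ◅ hub₀ (inj₂ refl) S-γ (flip i xa) a
  conn : ∀ i {s} → S s → Star (Link i) (xa , β , false) s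
  conn i (here refl) = ε
  conn i (there (here refl)) = to-y S P trunk⊆ S-x i
  conn i (there (there (here refl))) = to-hub i za
    ◅◅ (cross false , inj₂ refl , inj₂ (inj₁ (refl , target fz i)) , inj₂ (λ (s , _) → S-γ s))
    ◅ reverse link-sym (walk₁ (λ t → inj₂ (inj₁ (refl , t))) (λ _ _ → S-unique) (walk fz i))
  conn i (there (there (there (here refl)))) = to-hub i wa
    ◅◅ (cross false , inj₂ refl , inj₂ (inj₂ (refl , target fw i)) , inj₂ (λ (s , _) → S-γ s))
    ◅ reverse link-sym (walk₁ (λ t → inj₂ (inj₂ (refl , t))) (λ _ _ → S-unique) (walk fw i))

-- Growing trees leaf by leaf.

_≟V_ : ∀ {n} → DecidableEquality (Vertex n)
u ≟V v = map′ (cong vtx) (cong bits) (≡-dec Bool._≟_ (bits u) (bits v))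

module _ {n : ℕ} where
  open DecMembership (_≟V_ {n}) using (_∈?_)

  Edges : Set
  Edges = List (Vertex n × Vertex n)

  edge-sym : ∀ {E : Edges} {u v} → EdgeIn E u v → EdgeIn E v u
  edge-sym = Sum.swap

  walk-trans : ∀ {E : Edges} {u v w} → Walk E u v → Walk E v w → Walk E u w
  walk-trans stay        q = q
  walk-trans (step e p)  q = step e (walk-trans p q)

  walk-sym : ∀ {E : Edges} {u v} → Walk E u v → Walk E v u
  walk-sym stay       = stay
  walk-sym (step e p) = walk-trans (walk-sym p) (step (edge-sym e) stay)

  walk-weaken : ∀ {E : Edges} {u v} e → Walk E u v → Walk (e ∷ E) u v
  walk-weaken e stay       = stay
  walk-weaken e (step d p) = step (Sum.map there there d) (walk-weaken e p)

  module Leaf (E : Edges) {p v : Vertex n} (p≢v : p ≢ v)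
              (fresh : ∀ {a b} → (a , b) ∈ E → a ≢ v × b ≢ v) where

    E⁺ : Edges
    E⁺ = (p , v) ∷ E

    leaf-neighbour : ∀ {a} → EdgeIn E⁺ a v → a ≡ p
    leaf-neighbour (inj₁ (here refl)) = refl
    leaf-neighbour (inj₂ (here refl)) = contradiction refl p≢v
    leaf-neighbour (inj₁ (there e))   = contradiction refl (proj₂ (fresh e))
    leaf-neighbour (inj₂ (there e))   = contradiction refl (proj₁ (fresh e))

    old-edge : ∀ {a b} → a ≢ v → b ≢ v → EdgeIn E⁺ a b → EdgeIn E a b
    old-edge a≢v b≢v (inj₁ (here refl)) = contradiction refl b≢v
    old-edge a≢v b≢v (inj₂ (here refl)) = contradiction refl a≢v
    old-edge a≢v b≢v (inj₁ (there e))   = inj₁ e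
    old-edge a≢v b≢v (inj₂ (there e))   = inj₂ e

    old-chain : ∀ xs → All (_≢ v) xs → Chain E⁺ xs → Chain E xs
    old-chain []           _                  _        = tt
    old-chain (a ∷ [])     _                  _        = tt
    old-chain (a ∷ b ∷ xs) (a≢v ∷ b≢v ∷ all) (e , ch) =
      old-edge a≢v b≢v e , old-chain (b ∷ xs) (b≢v ∷ all) ch

    -- For a cycle based at the leaf `v`: the vertex before its return to `v` must be `p`.
    parent∈ : ∀ c xs → Chain E⁺ (c ∷ xs ++ [ v ]) → p ∈ c ∷ xs
    parent∈ c []       (e , _)  = here (sym (leaf-neighbour e))
    parent∈ c (d ∷ xs) (_ , ch) = there (parent∈ d xs ch)

    interior≢v : ∀ a b c → a ≢ c → EdgeIn E⁺ a b → EdgeIn E⁺ b c → b ≢ v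
    interior≢v a b c a≢c ab bc refl =
      a≢c (trans (leaf-neighbour ab) (sym (leaf-neighbour (edge-sym {E = E⁺} bc))))

    interiors≢v : ∀ a b xs z → Unique (a ∷ b ∷ xs) → All (z ≢_) (a ∷ b ∷ xs) →
                  Chain E⁺ (a ∷ b ∷ xs ++ [ z ]) → All (_≢ v) (b ∷ xs)
    interiors≢v a b []       z _ (z≢a ∷ _) (ab , bz , _) =
      interior≢v a b z (z≢a ∘ sym) ab bz ∷ []
    interiors≢v a b (c ∷ xs) z ((_ ∷ a≢c ∷ _) ∷ uniq) (_ ∷ z≢) (ab , bc , ch) =
      interior≢v a b c a≢c ab bc ∷ interiors≢v b c xs z uniq z≢ (bc , ch)

    -- The leaf `v` has the single neighbour `p`, while each vertex of a cycle has two distinct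
    -- neighbours on it. So a cycle misses `v` and uses old edges only.
    acyclic⁺ : ¬ HasCycle E → ¬ HasCycle E⁺
    acyclic⁺ acyclic (a , b , c , xs , uniq@((a≢b ∷ a≢c ∷ a≢xs) ∷ uniq′@(b≢ ∷ _)) , ch@(ab , bc , ch′)) =
      acyclic (a , b , c , xs , uniq , old-chain _ (a≢v ∷ b≢v ∷ All.++⁺ rest≢v (a≢v ∷ [])) ch)
      where
      b≢v : b ≢ v
      b≢v = interior≢v a b c a≢c ab bc
      rest≢v : All (_≢ v) (c ∷ xs)
      rest≢v = interiors≢v b c xs a uniq′ (a≢b ∷ a≢c ∷ a≢xs) (bc , ch′)
      a≢v : a ≢ v
      -- At the base point the two cyclic neighbours are `b` and the last vertex of `c ∷ xs`. Both
      -- would be `p`, against uniqueness.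
      a≢v refl = All.lookup b≢ (parent∈ c xs ch′) (leaf-neighbour (edge-sym {E = E⁺} ab))

  module Growth (R : Vertex n → Vertex n → Set) (root : Vertex n) where

    -- The invariant of growth. Connectedness is kept as reachability from `root`, and `vert-ok`
    -- ties every other vertex to an edge of `R`, from which the disjointness of different trees is
    -- read off.
    record Grown (T : Subgraph n) : Set where
      field
        edge-ok : ∀ {u v} → (u , v) ∈ edges T → R u v × u ∈ verts T × v ∈ verts T
        vert-ok : ∀ {v} → v ∈ verts T → v ≡ root ⊎ ∃ λ u → R u v
        reach   : ∀ {v} → v ∈ verts T → Walk (edges T) root v
        acyclic : ¬ HasCycle (edges T)
    open Grown

    seed : ∃ λ T → Grown T × root ∈ verts T
    seed = record { verts = root ∷ [] ; edges = [] } , record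
      { edge-ok = λ ()
      ; vert-ok = λ { (here refl) → inj₁ refl }
      ; reach   = λ { (here refl) → stay }
      ; acyclic = λ { (_ , _ , _ , _ , _ , inj₁ () , _) ; (_ , _ , _ , _ , _ , inj₂ () , _) }
      } , here refl

    add-leaf : ∀ {T u v} → Grown T → u ∈ verts T → ¬ v ∈ verts T → R u v →
               Grown (record { verts = v ∷ verts T ; edges = (u , v) ∷ edges T })
    add-leaf {T} {u} {v} g u∈ v∉ r = record
      { edge-ok = λ { (here refl) → r , there u∈ , here refl
                    ; (there e) → Product.map₂ (Product.map there there) (edge-ok g e) }
      ; vert-ok = λ { (here refl) → inj₂ (u , r) ; (there w∈) → vert-ok g w∈ }
      ; reach   = λ { (here refl) → walk-trans (walk-weaken _ (reach g u∈)) (step (inj₁ (here refl)) stay)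
                    ; (there w∈) → walk-weaken _ (reach g w∈) }
      ; acyclic = Leaf.acyclic⁺ (edges T) (λ { refl → v∉ u∈ })
          (λ e → let _ , a∈ , b∈ = edge-ok g e in (λ { refl → v∉ a∈ }) , (λ { refl → v∉ b∈ })) (acyclic g)
      }

    -- A vertex of the walk that is already in the tree is passed without adding an edge; a new one
    -- becomes a leaf. So no cycle arises, however often the walk returns to the tree.
    grow : ∀ {T u s} → Grown T → u ∈ verts T → Star R u s →
           ∃ λ T′ → Grown T′ × (∀ {v} → v ∈ verts T → v ∈ verts T′) × s ∈ verts T′
    grow {T} g u∈ ε = T , g , id , u∈
    grow {T} g u∈ (_◅_ {j = w} r rs) with w ∈? verts T
    ... | yes w∈ = grow g w∈ rs
    ... | no  w∉ = let T′ , g′ , ⊆ , s∈ = grow (add-leaf g u∈ w∉ r) (here refl) rs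
                   in T′ , g′ , ⊆ ∘ there , s∈

    grow-all : ∀ ss → (∀ {s} → s ∈ ss → Star R root s) →
               ∃ λ T → Grown T × root ∈ verts T × (∀ {s} → s ∈ ss → s ∈ verts T)
    grow-all []       conn = let T , g , r∈ = seed in T , g , r∈ , λ ()
    grow-all (s ∷ ss) conn =
      let T  , g  , r∈ , ss∈    = grow-all ss (conn ∘ there)
          T′ , g′ , ⊆  , s∈     = grow g r∈ (conn (here refl))
      in T′ , g′ , ⊆ r∈ , λ { (here refl) → s∈ ; (there s′∈) → ⊆ (ss∈ s′∈) }

    grown-tree : ∀ {T} → (∀ {u v} → R u v → Adjacent n u v) → Grown T → IsTree n T
    grown-tree R⊆ g =
      (λ e → let r , u∈ , v∈ = edge-ok g e in R⊆ r , u∈ , v∈) ,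
      (λ u∈ v∈ → walk-trans (walk-sym (reach g u∈)) (reach g v∈)) ,
      acyclic g

  Trees : ℕ → List (Vertex n) → Set
  Trees k S = Σ (Fin k → Subgraph n) (InternallyDisjointTrees n k S)

  -- Every edge of tree i is an `R i` edge, and each of its vertices is the root or the end of such
  -- an edge. Disjointness of the relations therefore passes to the trees, whichever walks they were
  -- grown from.
  build-trees : ∀ {k} (R : Fin k → Vertex n → Vertex n → Set) (root : Vertex n) (S : List (Vertex n)) →
    (∀ {i u v} → R i u v → Adjacent n u v) →
    (∀ {i u v} → R i u v → R i v u) →
    (∀ {i j u v} → i ≢ j → R i u v → ¬ R j u v) →
    (∀ {i j u u′ v} → i ≢ j → R i u v → R j u′ v → v ∈ S) →
    root ∈ S → (∀ i {s} → s ∈ S → Star (R i) root s) → Trees k S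
  build-trees {k} R root S R⊆ R-sym edge-disj vert-disj root∈ conn = tree ,
    (λ i → grown-tree i R⊆ (grown i)) ,
    (λ i → proj₂ (proj₂ (proj₂ (span i)))) ,
    (λ i j i≢j e e′ → edge-disj i≢j (used i e) (used j e′)) ,
    λ i j i≢j v∈ v∈′ → meet i≢j (vert-ok (grown i) v∈) (vert-ok (grown j) v∈′)
    where
    module G i = Growth (R i) root
    open G using (grow-all; grown-tree; Grown)
    open Growth.Grown using (edge-ok; vert-ok)
    span : ∀ i → ∃ λ T → Grown i T × root ∈ verts T × (∀ {s} → s ∈ S → s ∈ verts T)
    span i = grow-all i S (conn i)
    tree : Fin k → Subgraph n
    tree i = proj₁ (span i)
    grown : ∀ i → Grown i (tree i)
    grown i = proj₁ (proj₂ (span i))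
    used : ∀ i {u v} → EdgeIn (edges (tree i)) u v → R i u v
    used i (inj₁ e) = proj₁ (edge-ok (grown i) e)
    used i (inj₂ e) = R-sym (proj₁ (edge-ok (grown i) e))
    meet : ∀ {i j v} → i ≢ j → v ≡ root ⊎ (∃ λ u → R i u v) → v ≡ root ⊎ (∃ λ u → R j u v) → v ∈ S
    meet i≢j (inj₁ refl)    _              = root∈
    meet i≢j (inj₂ _)       (inj₁ refl)    = root∈
    meet i≢j (inj₂ (_ , r)) (inj₂ (_ , r′)) = vert-disj i≢j r r′

  reorder : ∀ {k S S′} → S ↭ S′ → Trees k S → Trees k S′
  reorder σ (T , trees , contain , edge-disj , vert-disj) =
    T , trees , (λ i → contain i ∘ ∈-resp-↭ (↭-sym σ)) , edge-disj ,
    λ i j i≢j u∈ v∈ → ∈-resp-↭ σ (vert-disj i j i≢j u∈ v∈)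

-- Nodes as bit strings: adjacency and clusters.

-- Positions count from 0 here but from 1 in `bitL`, hence the `suc i` in `differs` and `agrees`.
data DiffersAt : ∀ {k} → ℕ → Vec Bool k → Vec Bool k → Set where
  here  : ∀ {k b b′} {v : Vec Bool k} → b ≢ b′ → DiffersAt 0 (b ∷ v) (b′ ∷ v)
  there : ∀ {k i b} {v w : Vec Bool k} → DiffersAt i v w → DiffersAt (suc i) (b ∷ v) (b ∷ w)

private variable
  k i : ℕ
  u v : Vec Bool k

differs : DiffersAt i u v → bitL (toList u) (suc i) ≢ bitL (toList v) (suc i)
differs (here b≢b′) = b≢b′
differs (there d)   = differs d

agrees : DiffersAt i u v → ∀ j → j ≢ suc i → bitL (toList u) j ≡ bitL (toList v) j
agrees (here _)  zero          _    = refl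
agrees (here _)  (suc zero)    j≢   = contradiction refl j≢
agrees (here _)  (suc (suc j)) _    = refl
agrees (there d) zero          _    = refl
agrees (there d) (suc zero)    _    = refl
agrees (there d) (suc (suc j)) j≢   = agrees d (suc j) (j≢ ∘ cong suc)

flip-differs : ∀ (i : Fin m) u → DiffersAt (toℕ i) u (flip i u)
flip-differs zero    (b ∷ u) = here (not≢ b ∘ sym)
flip-differs (suc i) (b ∷ u) = there (flip-differs i u)

differs-++ˡ : (a : Vec Bool m) → DiffersAt i u v → DiffersAt (m + i) (a Vec.++ u) (a Vec.++ v)
differs-++ˡ []      d = d
differs-++ˡ (_ ∷ a) d = there (differs-++ˡ a d)

differs-++ʳ : (w : Vec Bool m) → DiffersAt i u v → DiffersAt i (u Vec.++ w) (v Vec.++ w)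
differs-++ʳ w (here b≢b′) = here b≢b′
differs-++ʳ w (there d)   = there (differs-++ʳ w d)

-- Data.Vec._∷ʳ_ has length m + 1, whereas 2n − 1 unfolds to m + suc (m + 0).
snoc : Vec Bool m → Bool → Vec Bool (suc (m + 0))
snoc []      c = c ∷ []
snoc (b ∷ v) c = b ∷ snoc v c

differs-snoc : ∀ c → DiffersAt i u v → DiffersAt i (snoc u c) (snoc v c)
differs-snoc c (here b≢b′) = here b≢b′
differs-snoc c (there d)   = there (differs-snoc c d)

differs-last : ∀ (u : Vec Bool m) c → DiffersAt m (snoc u c) (snoc u (not c))
differs-last []      c = here (not≢ c ∘ sym)
differs-last (_ ∷ u) c = there (differs-last u c)

snoc-injective : ∀ (u v : Vec Bool m) {c d} → snoc u c ≡ snoc v d → u ≡ v × c ≡ d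
snoc-injective []      []      refl = refl , refl
snoc-injective (_ ∷ u) (_ ∷ v) e    =
  Product.map₁ (cong₂ _∷_ (∷-injectiveˡ e)) (snoc-injective u v (∷-injectiveʳ e))

unsnoc : ∀ m (v : Vec Bool (suc (m + 0))) → ∃ λ u → ∃ λ c → v ≡ snoc {m} u c
unsnoc zero    (c ∷ [])    = [] , c , refl
unsnoc (suc m) (b ∷ v) = let u , c , e = unsnoc m v in b ∷ u , c , cong (b ∷_) e

encode : Node m → Vertex (suc m)
encode (a , b , c) = vtx (a Vec.++ snoc b c)

encode-injective : (p q : Node m) → encode p ≡ encode q → p ≡ q
encode-injective (a , b , c) (a′ , b′ , c′) e =
  let a≡ , r≡ = ++-injective a a′ (cong bits e)
      b≡ , c≡ = snoc-injective b b′ r≡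
  in cong₂ _,_ a≡ (cong₂ _,_ b≡ c≡)

decoding : (u : Vertex (suc m)) → ∃ λ p → encode p ≡ u
decoding {m} (vtx v) =
  let a , r , e = splitAt m v
      b , c , e′ = unsnoc m r
  in (a , b , c) , cong vtx (trans (cong (a Vec.++_) (sym e′)) (sym e))

decode : Vertex (suc m) → Node m
decode u = proj₁ (decoding u)

encode-decode : (u : Vertex (suc m)) → encode (decode u) ≡ u
encode-decode u = proj₂ (decoding u)

decode-encode : (p : Node m) → decode (encode p) ≡ p
decode-encode p = encode-injective _ _ (encode-decode (encode p))

-- The index has the form `suc j` because `bitL` returns the default `false` at 0, where the left
-- side would read the last bit of a nonempty `a`.
bitL-++ : (a : Vec Bool m) (r : Vec Bool k) (j : ℕ) → bitL (toList (a Vec.++ r)) (m + suc j) ≡ bitL (toList r) (suc j)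
bitL-++ []              r j = refl
-- The rewriting exposes a second `suc`, which `bitL` needs in order to drop the head.
bitL-++ {suc m} (_ ∷ a) r j rewrite +-suc m j = trans (cong (bitL (toList (a Vec.++ r))) (sym (+-suc m j))) (bitL-++ a r j)

bitL-snoc : (b : Vec Bool m) (c : Bool) → bitL (toList (snoc b c)) (suc (m + 0)) ≡ c
bitL-snoc []      c = refl
bitL-snoc (_ ∷ b) c = bitL-snoc b c

lastBit-encode : (p : Node m) → lastBit (encode p) ≡ proj₂ (proj₂ p)
lastBit-encode {m} (a , b , c) = trans (bitL-++ a (snoc b c) (m + 0)) (bitL-snoc b c)

-- With n = m + 1, the moves `move₀`, `move₁` and `cross` change one of the first m bits, one of the
-- next m bits and bit 2m + 1 = 2n - 1. These are the three alternatives of `Adjacent`.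
adjacent-encode : {p q : Node m} → Adj p q → Adjacent (suc m) (encode p) (encode q)
adjacent-encode {m} (move₀ {a} {b} i) =
  suc (toℕ i) , s≤s z≤n , ≤-trans (toℕ<n i) (m≤m+n m _) , differs d , agrees d ,
  inj₁ (toℕ<n i , lastBit-encode (a , b , false) , lastBit-encode (flip i a , b , false))
  where d = differs-++ʳ (snoc b false) (flip-differs i a)
adjacent-encode {m} (move₁ {a} {b} i) =
  suc (m + toℕ i) , s≤s z≤n , subst (suc (m + toℕ i) ≤_) (sym (+-suc m (m + 0))) (s≤s bound′) , differs d , agrees d ,
  inj₂ (inj₁ (s≤s (m≤m+n m _) , subst (suc (m + toℕ i) ≤_) (sym (cong (_∸ 1) (+-suc m (m + 0)))) bound ,
    lastBit-encode (a , b , true) , lastBit-encode (a , flip i b , true)))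
  where
  d = differs-++ˡ a (differs-snoc true (flip-differs i b))
  bound : suc (m + toℕ i) ≤ m + (m + 0)
  bound = subst₂ _≤_ (+-suc m (toℕ i)) (cong (m +_) (sym (+-identityʳ m))) (+-monoʳ-≤ m (toℕ<n i))
  bound′ : m + toℕ i ≤ m + (m + 0)
  bound′ = ≤-trans (n≤1+n _) bound
adjacent-encode {m} (cross {a} {b} c) =
  suc (m + m) , s≤s z≤n , ≤-reflexive index , differs d , agrees d , inj₂ (inj₂ index)
  where
  d = differs-++ˡ a (differs-last b c)
  index : suc (m + m) ≡ m + suc (m + 0)
  index = trans (sym (+-suc m m)) (cong (λ k → m + suc k) (sym (+-identityʳ m)))

cluster : Node m → Bool × Cube m
cluster (a , b , false) = false , b
cluster (a , b , true)  = true , a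

positions-map : ∀ (f : ℕ → Bool) a k → map f (positions a k) ≡ applyUpTo (λ j → f (a + j)) k
positions-map f a k = trans (cong (map f) (map-upTo (a +_) k)) (map-applyUpTo (a +_) f k)

read-prefix : (a : Vec Bool m) (r : Vec Bool k) → applyUpTo (λ j → bitL (toList (a Vec.++ r)) (suc j)) m ≡ toList a
read-prefix []      r = refl
read-prefix (b ∷ a) r = cong (b ∷_) (read-prefix a r)

read-snoc : (b : Vec Bool m) (c : Bool) → applyUpTo (λ j → bitL (toList (snoc b c)) (suc j)) m ≡ toList b
read-snoc []      c = refl
read-snoc (x ∷ b) c = cong (x ∷_) (read-snoc b c)

applyUpTo-cong : ∀ {f g : ℕ → Bool} → (∀ j → f j ≡ g j) → ∀ k → applyUpTo f k ≡ applyUpTo g k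
applyUpTo-cong f≗g zero    = refl
applyUpTo-cong f≗g (suc k) = cong₂ _∷_ (f≗g 0) (applyUpTo-cong (f≗g ∘ suc) k)

clusterOf-encode : (p : Node m) → clusterOf (suc m) (encode p) ≡ Product.map₂ toList (cluster p)
clusterOf-encode {m} p@(a , b , c) with lastBit (encode p) | lastBit-encode p
... | true  | refl = cong (true ,_) (trans (positions-map _ 1 m) (read-prefix a (snoc b c)))
... | false | refl = cong (false ,_) (trans (positions-map _ (suc m) m)
  (trans (applyUpTo-cong (λ j → trans (cong (bitL (toList (a Vec.++ snoc b c))) (sym (+-suc m j))) (bitL-++ a (snoc b c) j)) m)
    (read-snoc b c)))

clusterOf-decode : (u : Vertex (suc m)) → clusterOf (suc m) u ≡ Product.map₂ toList (cluster (decode u))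
clusterOf-decode {m} u = trans (cong (clusterOf (suc m)) (sym (encode-decode u))) (clusterOf-encode (decode u))

cluster-preserve : (u v : Vertex (suc m)) → cluster (decode u) ≡ cluster (decode v) →
                   clusterOf (suc m) u ≡ clusterOf (suc m) v
cluster-preserve u v e =
  trans (clusterOf-decode u) (trans (cong (Product.map₂ toList) e) (sym (clusterOf-decode v)))

cluster-reflect : (u v : Vertex (suc m)) → clusterOf (suc m) u ≡ clusterOf (suc m) v →
                  cluster (decode u) ≡ cluster (decode v)
cluster-reflect {m} u v e = unlist (trans (sym (clusterOf-decode u)) (trans e (clusterOf-decode v)))
  where
  unlist : ∀ {s t : Bool × Cube m} → Product.map₂ toList s ≡ Product.map₂ toList t → s ≡ t
  unlist {_ , a} {_ , b} e =
    cong₂ _,_ (cong proj₁ e) (trans (sym (cast-is-id refl a)) (toList-injective refl a b (cong proj₂ e)))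

-- Symmetry, and trees from systems.

-- The automorphism of the dual cube that swaps the two classes of clusters; it reduces a pair in
-- class 1 to a pair in class 0.
exchange : Node m → Node m
exchange (a , b , c) = b , a , not c

exchange-involutive : (p : Node m) → exchange (exchange p) ≡ p
exchange-involutive (a , b , c) = cong (λ c → a , b , c) (not-involutive c)

exchange-adj : {p q : Node m} → Adj p q → Adj (exchange p) (exchange q)
exchange-adj (move₀ i) = move₁ i
exchange-adj (move₁ i) = move₀ i
exchange-adj (cross c) = cross (not c)

-- Parts are pulled back along an involutive automorphism. It is applied to `exchange`, and to `id`
-- in order to replace `S` by a set with the same members, such as a permuted list.
transport-system : ∀ {S S′ : Node m → Set} (σ : Node m → Node m) → (∀ v → σ (σ v) ≡ v) →
  (∀ {u v} → Adj u v → Adj (σ u) (σ v)) → (∀ v → S v → S′ (σ v)) → (∀ v → S′ v → S (σ v)) →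
  ∀ {root} → System S (σ root) → System S′ root
transport-system {m} {S} {S′} σ invol σ-adj S⊆ S′⊆ {root} sys = record
  { Part          = P
  ; Exempt        = Exempt
  ; exempt-unique = exempt-unique
  ; root∈         = root∈
  ; meet          = λ i≢j v v∈ v∈′ → subst S′ (invol v) (S⊆ _ (meet i≢j (σ v) v∈ v∈′))
  ; connected     = λ i {s} s∈ → subst₂ (Star (Link′ i)) (invol root) (invol s)
      (gmap σ link (connected i (S′⊆ s s∈)))
  }
  where
  open System sys
  P : Fin m → Node m → Set
  P i v = Part i (σ v)
  open Linked S′ P Exempt using () renaming (Link to Link′)
  link : ∀ {i u v} → Link i u v → Link′ i (σ u) (σ v)
  link {i} {u} {v} (uv , u∈ , v∈ , ok) =
    σ-adj uv , subst (Part i) (sym (invol u)) u∈ , subst (Part i) (sym (invol v)) v∈ ,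
    Sum.map₂ (λ ¬S (u , v) → ¬S (subst S (invol _) (S′⊆ _ u) , subst S (invol _) (S′⊆ _ v))) ok

-- By `meet`, an edge lying in two parts has both ends in `L`. Then both parts are exempt, against
-- `exempt-unique`.
system-trees : ∀ {L : List (Node m)} {root} → root ∈ L → System (_∈ L) root → Trees m (map encode L)
system-trees {m} {L} {root} root∈L sys = build-trees R (encode root) (map encode L)
  (λ {_} {u} {v} r → subst₂ (Adjacent (suc m)) (encode-decode u) (encode-decode v) (adjacent-encode (proj₁ r)))
  link-sym
  (λ i≢j (_ , u∈ , v∈ , ok) (_ , u∈′ , v∈′ , ok′) →
    both-exempt i≢j (meet i≢j _ u∈ u∈′) (meet i≢j _ v∈ v∈′) ok ok′)
  (λ {_} {_} {_} {_} {v} i≢j (_ , _ , v∈ , _) (_ , _ , v∈′ , _) →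
    subst (_∈ map encode L) (encode-decode v) (∈-map⁺ encode (meet i≢j _ v∈ v∈′)))
  (∈-map⁺ encode root∈L)
  (λ i s∈ → connect i (∈-map⁻ encode s∈))
  where
  open System sys
  R : Fin m → Vertex (suc m) → Vertex (suc m) → Set
  R i u v = Link i (decode u) (decode v)
  both-exempt : ∀ {i j u v} → i ≢ j → u ∈ L → v ∈ L →
                Exempt i ⊎ ¬ (u ∈ L × v ∈ L) → Exempt j ⊎ ¬ (u ∈ L × v ∈ L) → ⊥
  both-exempt i≢j u∈ v∈ (inj₁ x) (inj₁ y) = i≢j (exempt-unique x y)
  both-exempt i≢j u∈ v∈ (inj₂ ¬S) _       = ¬S (u∈ , v∈)
  both-exempt i≢j u∈ v∈ (inj₁ _) (inj₂ ¬S) = ¬S (u∈ , v∈)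
  connect : ∀ i {s} → (∃ λ p → p ∈ L × s ≡ encode p) → Star (R i) (encode root) s
  connect i (p , p∈ , refl) = gmap encode
    (λ {u} {v} → subst₂ (Link i) (sym (decode-encode u)) (sym (decode-encode v))) (connected i p∈)

-- The case distinction.

-- For adjacent β and β₁ the complement of β is far from both, as m ≥ 3.
centre-away : 3 ≤ m → (β β₁ : Cube m) → ∃ λ c → (∀ i → flip i c ≢ β) × (∀ i → flip i c ≢ β₁)
centre-away m≥3 β β₁ with any? (λ k → β₁ ≟Q flip k β)
-- When `β₁` is not a neighbour of `β`, the centre can be `β` itself.
... | no ∄k = β , (λ i → flip≢ i β) , λ i e → ∄k (i , sym e)
centre-away (s≤s (s≤s (s≤s _))) β@(b₀ ∷ b₁ ∷ b₂ ∷ _) _ | yes (k , refl) = Vec.map not β , far₁ , λ i → far₂ i k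
  where
  far₁ : ∀ i → flip i (Vec.map not β) ≢ β
  far₁ zero    = not≢ b₁ ∘ ∷-injectiveˡ ∘ ∷-injectiveʳ
  far₁ (suc i) = not≢ b₀ ∘ ∷-injectiveˡ
  -- The two vertices differ at every position other than i and k, and one of the first three
  -- positions is such.
  far₂ : ∀ i k → flip i (Vec.map not β) ≢ flip k β
  far₂ zero          zero          = not≢ b₁ ∘ ∷-injectiveˡ ∘ ∷-injectiveʳ
  far₂ zero          (suc zero)    = not≢ b₂ ∘ ∷-injectiveˡ ∘ ∷-injectiveʳ ∘ ∷-injectiveʳ
  far₂ zero          (suc (suc k)) = not≢ b₁ ∘ ∷-injectiveˡ ∘ ∷-injectiveʳ
  far₂ (suc zero)    zero          = not≢ b₂ ∘ ∷-injectiveˡ ∘ ∷-injectiveʳ ∘ ∷-injectiveʳ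
  far₂ (suc (suc i)) zero          = not≢ b₁ ∘ ∷-injectiveˡ ∘ ∷-injectiveʳ
  far₂ (suc i)       (suc k)       = not≢ b₀ ∘ ∷-injectiveˡ

OnePair : {A : Set} → A → A → A → A → Set
OnePair p q r s = p ≡ q × p ≢ r × p ≢ s × r ≢ s

-- The pair x, y shares a class 0 cluster, so the classes of z and w select the configuration. If z
-- is in class 1 and w in class 0, the two change places.
system-class₀ : 3 ≤ m → ∀ {xa xb} (y z w : Node m) → (xa , xb , false) ≢ y →
  OnePair (false , xb) (cluster y) (cluster z) (cluster w) →
  System (_∈ (xa , xb , false) ∷ y ∷ z ∷ w ∷ []) (xa , xb , false)
system-class₀ m≥3 (ya , _ , false) (za , zb , false) (wa , wb , false) x≢y (refl , x≢z , x≢w , z≢w) =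
  system₀₀ _ ya za wa _ zb wb (x≢y ∘ cong (_, _)) (x≢z ∘ cong (_ ,_)) (x≢w ∘ cong (_ ,_)) (z≢w ∘ cong (_ ,_))
system-class₀ m≥3 {xb = xb} (ya , _ , false) (za , zb , false) (wa , wb , true) x≢y (refl , x≢z , _) =
  let c , γ≢β , γ≢β₁ = centre-away m≥3 xb zb
  in system₀₁ _ ya za wa _ zb wb c (x≢y ∘ cong (_, _)) (x≢z ∘ cong (_ ,_)) γ≢β γ≢β₁
system-class₀ m≥3 (ya , _ , false) (za , zb , true) (wa , wb , true) x≢y (refl , _ , _ , z≢w) =
  system₁₁ _ ya _ za zb wa wb (x≢y ∘ cong (_, _)) (z≢w ∘ cong (_ ,_))
system-class₀ m≥3 {xb = xb} y@(ya , _ , false) z@(za , zb , true) w@(wa , wb , false) x≢y (refl , _ , x≢w , _) =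
  let c , γ≢β , γ≢β₁ = centre-away m≥3 xb wb
  in transport-system id (λ _ → refl) id (λ _ → ∈-resp-↭ σ) (λ _ → ∈-resp-↭ (↭-sym σ))
       (system₀₁ _ ya wa za _ wb zb c (x≢y ∘ cong (_, _)) (x≢w ∘ cong (_ ,_)) γ≢β γ≢β₁)
  where
  σ : ∀ {x} → x ∷ y ∷ w ∷ z ∷ [] ↭ x ∷ y ∷ z ∷ w ∷ []
  σ = ↭.prep _ (↭.prep _ (↭.swap _ _ ↭-refl))

cluster-exchange : (p q : Node m) → cluster p ≡ cluster q → cluster (exchange p) ≡ cluster (exchange q)
cluster-exchange (_ , _ , false) (_ , _ , false) refl = refl
cluster-exchange (_ , _ , true)  (_ , _ , true)  refl = refl

cluster-unexchange : (p q : Node m) → cluster (exchange p) ≡ cluster (exchange q) → cluster p ≡ cluster q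
cluster-unexchange p q e =
  subst₂ _≡_ (cong cluster (exchange-involutive p)) (cong cluster (exchange-involutive q)) (cluster-exchange _ _ e)

system : 3 ≤ m → (x y z w : Node m) → x ≢ y → OnePair (cluster x) (cluster y) (cluster z) (cluster w) →
  System (_∈ x ∷ y ∷ z ∷ w ∷ []) x
system m≥3 (_ , _ , false) y z w x≢y pair = system-class₀ m≥3 y z w x≢y pair
system m≥3 x@(_ , _ , true) y z w x≢y (e , x≢z , x≢w , z≢w) =
  transport-system exchange exchange-involutive exchange-adj
    (λ v v∈ → subst (λ L → exchange v ∈ L) unexchange (∈-map⁺ exchange v∈)) (λ v → ∈-map⁺ exchange)
    (system-class₀ m≥3 (exchange y) (exchange z) (exchange w) (λ e → x≢y (exchange-injective e))
      (cluster-exchange x y e , x≢z ∘ cluster-unexchange x z , x≢w ∘ cluster-unexchange x w , z≢w ∘ cluster-unexchange z w))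
  where
  L = x ∷ y ∷ z ∷ w ∷ []
  unexchange : map exchange (map exchange L) ≡ L
  unexchange = trans (sym (map-∘ {g = exchange} {f = exchange} L)) (trans (map-cong exchange-involutive L) (map-id L))
  exchange-injective : ∀ {p q} → exchange p ≡ exchange q → p ≡ q
  exchange-injective e = trans (sym (exchange-involutive _)) (trans (cong exchange e) (exchange-involutive _))

trees-paired : 3 ≤ m → (x y z w : Vertex (suc m)) → x ≢ y → let cl = clusterOf (suc m) in
  OnePair (cl x) (cl y) (cl z) (cl w) → Trees m (x ∷ y ∷ z ∷ w ∷ [])
trees-paired {m} m≥3 x y z w x≢y (e , x≢z , x≢w , z≢w) =
  subst (Trees m) (trans (sym (map-∘ {g = encode} {f = decode} L)) (trans (map-cong encode-decode L) (map-id L)))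
    (system-trees (here refl) (system m≥3 (decode x) (decode y) (decode z) (decode w) (x≢y ∘ decode-injective)
      (cluster-reflect x y e , x≢z ∘ cluster-preserve x z , x≢w ∘ cluster-preserve x w , z≢w ∘ cluster-preserve z w)))
  where
  L = x ∷ y ∷ z ∷ w ∷ []
  decode-injective : ∀ {u v} → decode u ≡ decode v → u ≡ v
  decode-injective {u} {v} e = trans (sym (encode-decode u)) (trans (cong encode e) (encode-decode v))

-- The branches follow the comparisons made by `deduplicate`, which works from the end of the list.
-- Each branch yields a wrong length, a contradiction or exactly one coinciding pair.
three-classes : {A : Set} (_≟_ : DecidableEquality A) (a b c d : A) →
  length (deduplicate _≟_ (a ∷ b ∷ c ∷ d ∷ [])) ≡ 3 →
  OnePair a b c d ⊎ OnePair a c b d ⊎ OnePair a d b c ⊎ OnePair b c a d ⊎ OnePair b d a c ⊎ OnePair c d a b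
three-classes _≟_ a b c d three with c ≟ d
three-classes _≟_ a b c d three | yes refl with b ≟ c
three-classes _≟_ a b c d three | yes refl | yes refl with a ≟ c
three-classes _≟_ a b c d () | yes refl | yes refl | yes _
three-classes _≟_ a b c d () | yes refl | yes refl | no _
three-classes _≟_ a b c d three | yes refl | no b≢c with a ≟ b
-- Once `a` is identified with `b`, the pending test of `a` against `c` is `b ≟ c` again and has to
-- be decided anew.
three-classes _≟_ a b c d three | yes refl | no b≢c | yes refl with b ≟ c
three-classes _≟_ a b c d three | yes refl | no b≢c | yes refl | yes b≡c = contradiction b≡c b≢c
three-classes _≟_ a b c d () | yes refl | no b≢c | yes refl | no _
three-classes _≟_ a b c d three | yes refl | no b≢c | no a≢b with a ≟ c
three-classes _≟_ a b c d () | yes refl | no b≢c | no a≢b | yes _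
three-classes _≟_ a b c d three | yes refl | no b≢c | no a≢b | no a≢c =
  inj₂ (inj₂ (inj₂ (inj₂ (inj₂ (refl , a≢c ∘ sym , b≢c ∘ sym , a≢b)))))
three-classes _≟_ a b c d three | no c≢d with b ≟ c
three-classes _≟_ a b c d three | no c≢d | yes refl with b ≟ d
three-classes _≟_ a b c d three | no c≢d | yes refl | yes b≡d = contradiction b≡d c≢d
three-classes _≟_ a b c d three | no c≢d | yes refl | no _ with a ≟ b
three-classes _≟_ a b c d three | no c≢d | yes refl | no _ | yes refl with b ≟ d
three-classes _≟_ a b c d three | no c≢d | yes refl | no _ | yes refl | yes b≡d = contradiction b≡d c≢d
three-classes _≟_ a b c d () | no c≢d | yes refl | no _ | yes refl | no _
three-classes _≟_ a b c d three | no c≢d | yes refl | no _ | no a≢b with a ≟ d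
three-classes _≟_ a b c d () | no c≢d | yes refl | no _ | no a≢b | yes _
three-classes _≟_ a b c d three | no c≢d | yes refl | no _ | no a≢b | no a≢d =
  inj₂ (inj₂ (inj₂ (inj₁ (refl , a≢b ∘ sym , c≢d , a≢d))))
three-classes _≟_ a b c d three | no c≢d | no b≢c with b ≟ d
three-classes _≟_ a b c d three | no c≢d | no b≢c | yes refl with a ≟ b
three-classes _≟_ a b c d three | no c≢d | no b≢c | yes refl | yes refl with b ≟ c
three-classes _≟_ a b c d three | no c≢d | no b≢c | yes refl | yes refl | yes b≡c = contradiction b≡c b≢c
three-classes _≟_ a b c d () | no c≢d | no b≢c | yes refl | yes refl | no _
three-classes _≟_ a b c d three | no c≢d | no b≢c | yes refl | no a≢b with a ≟ c
three-classes _≟_ a b c d () | no c≢d | no b≢c | yes refl | no a≢b | yes _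
three-classes _≟_ a b c d three | no c≢d | no b≢c | yes refl | no a≢b | no a≢c =
  inj₂ (inj₂ (inj₂ (inj₂ (inj₁ (refl , a≢b ∘ sym , b≢c , a≢c)))))
three-classes _≟_ a b c d three | no c≢d | no b≢c | no b≢d with a ≟ b
three-classes _≟_ a b c d three | no c≢d | no b≢c | no b≢d | yes refl = inj₁ (refl , b≢c , b≢d , c≢d)
three-classes _≟_ a b c d three | no c≢d | no b≢c | no b≢d | no a≢b with a ≟ c
three-classes _≟_ a b c d three | no c≢d | no b≢c | no b≢d | no a≢b | yes refl = inj₂ (inj₁ (refl , a≢b , c≢d , b≢d))
three-classes _≟_ a b c d three | no c≢d | no b≢c | no b≢d | no a≢b | no a≢c with a ≟ d
three-classes _≟_ a b c d three | no c≢d | no b≢c | no b≢d | no a≢b | no a≢c | yes refl = inj₂ (inj₂ (inj₁ (refl , a≢b , a≢c , b≢c)))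
three-classes _≟_ a b c d () | no c≢d | no b≢c | no b≢d | no a≢b | no a≢c | no _

theorem9 : (n : ℕ) → 4 ≤ n → (x y z w : Vertex n)
    → Unique (x ∷ y ∷ z ∷ w ∷ [])
    → numClusters n (x ∷ y ∷ z ∷ w ∷ []) ≡ 3
    → Σ (Fin (n ∸ 1) → Subgraph n) λ T →
    InternallyDisjointTrees n (n ∸ 1) (x ∷ y ∷ z ∷ w ∷ []) T
theorem9 (suc m) (s≤s m≥3) x y z w
  ((x≢y ∷ x≢z ∷ x≢w ∷ []) ∷ (y≢z ∷ y≢w ∷ []) ∷ (z≢w ∷ []) ∷ [] ∷ []) three
  with three-classes _≟C_ _ _ _ _ three
-- The coinciding pair is brought to the front in each case, and `reorder` restores the given order.
... | inj₁ xy = trees-paired m≥3 x y z w x≢y xy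
... | inj₂ (inj₁ xz) = reorder (↭.prep x (↭.swap z y ↭-refl)) (trees-paired m≥3 x z y w x≢z xz)
... | inj₂ (inj₂ (inj₁ xw)) =
  reorder (↭.prep x (++-comm (w ∷ []) (y ∷ z ∷ []))) (trees-paired m≥3 x w y z x≢w xw)
... | inj₂ (inj₂ (inj₂ (inj₁ yz))) = reorder (shift x (y ∷ z ∷ []) (w ∷ [])) (trees-paired m≥3 y z x w y≢z yz)
... | inj₂ (inj₂ (inj₂ (inj₂ (inj₁ yw)))) =
  reorder (↭-trans (shift x (y ∷ w ∷ []) (z ∷ [])) (↭.prep x (↭.prep y (↭.swap w z ↭-refl))))
    (trees-paired m≥3 y w x z y≢w yw)
... | inj₂ (inj₂ (inj₂ (inj₂ (inj₂ zw)))) =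
  reorder (++-comm (z ∷ w ∷ []) (x ∷ y ∷ [])) (trees-paired m≥3 z w x y z≢w zw)
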